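{- For every integer $n\geq 1$, the following identities hold: (1) $15F_{2(2n-1)}=5\cdot4^n-20\cdot4^{ -n}+11\sum_{k=1}^{n-1}\bigl(4^{k}-4^{ -k}\bigr)F_{2(2n-2k-1)}$; (2) $15F_{4n}=12\bigl(4^n-4^{ -n}\bigr)+11\sum_{k=1}^{n-1}\bigl(4^{k}-4^{ -k}\bigr)F_{4(n-k)}$; (3) $15F_{2n}=4\bigl(4^n-4^{ -n}\bigr)-5\sum_{k=1}^{n-1}\bigl(4^{k}-4^{ -k}\bigr)F_{2(n-k)}$; (4) $15L_{4(n-1)}=4^n+104\cdot4^{ -n}+11\sum_{k=1}^{n-1}\bigl(4^{k}-4^{ -k}\bigr)L_{4(n-k-1)}$; (5) $15L_{2(2n-1)}=9\cdot4^n+36\cdot4^{ -n}+11\sum_{k=1}^{n-1}\bigl(4^{k}-4^{ -k}\bigr)L_{2(2n-2k-1)}$; (6) $3L_{2n-2}=4^n+8\cdot4^{ -n}-\sum_{k=0}^{n-1}\bigl(4^{k}-4^{ -k}\bigr)L_{2(n-k-1)}$.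
   Context: $F_n$ and $L_n$ denote the Fibonacci and Lucas numbers: $F_0=0$, $F_1=1$, $L_0=2$, $L_1=1$, each satisfying $w_n=w_{n-1}+w_{n-2}$ for $n\ge 2$. A sum whose upper limit is smaller than its lower limit is $0$. -}

module Defs where

open import Data.Fin.Base using (toℕ)
open import Data.Integer.Base using (ℤ; +_; -[1+_])
open import Data.Nat.Base as ℕ using (ℕ; zero; suc; _∸_)
open import Data.Rational.Base using (ℚ; NonZero; 1/_; _/_; +-*-rawSemiring)
import Algebra.Definitions.RawSemiring +-*-rawSemiring as ℚ-Semiring

F : ℕ → ℕ
F 0             = 0
F 1             = 1
F (suc (suc n)) = F (suc n) ℕ.+ F n

L : ℕ → ℕ
L 0             = 2
L 1             = 1
L (suc (suc n)) = L (suc n) ℕ.+ L n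

ι : ℕ → ℚ
ι n = + n / 1

infixr 8 _^_

_^_ : (q : ℚ) .{{_ : NonZero q}} → ℤ → ℚ
q ^ (+ n)    = q ℚ-Semiring.^ n
q ^ -[1+ n ] = (1/ q) ℚ-Semiring.^ suc n

-- Both bounds are inclusive. There are suc b ∸ a summands, hence none
-- when b < a.
sumFromTo : ℕ → ℕ → (ℕ → ℚ) → ℚ
sumFromTo a b f = ℚ-Semiring.sum {suc b ∸ a} (λ i → f (a ℕ.+ toℕ i))

-- Binds tighter than the arithmetic operators, so a compound summand
-- has to be parenthesised.
infixl 10 sumFromTo
syntax sumFromTo a b (λ k → x) = ∑[ k from a to b ] x

{-# OPTIONS --safe #-}
module Submission where

-- The Fibonacci or Lucas numbers a 0, a 1, … in a sum, read from its last term
-- backwards, satisfy a (2 + j) + a j = p a (1 + j), where p = 7 if their indices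
-- increase in steps of 4 and p = 3 if in steps of 2.
-- Dropping a 0 from the sequence shortens the convolution with 4ᵏ − 4⁻ᵏ by its
-- last term, which gives a closed form by induction on the length. The factor
-- 4p − 17 comes from the recurrence 4 d (2 + k) + 4 d k = 17 d (1 + k)
-- of d k = 4ᵏ − 4⁻ᵏ; it is 11 for p = 7 and −5 for p = 3.

open import Defs
open import Data.Fin.Base using (toℕ)
open import Data.Fin.Properties using (toℕ-inject₁; toℕ-fromℕ)
open import Data.Integer.Base as ℤ using (+_; -_)
import Data.Integer.Properties as ℤ
import Data.Nat.Coprimality as Coprimality
open import Data.Nat.Base as ℕ using (ℕ; zero; suc; _∸_; _≥_)
import Data.Nat.Properties as ℕ
import Data.Nat.Solver as ℕ
open import Data.Product.Base using (_×_; _,_)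
open import Data.Rational.Base as ℚ using (ℚ; 1/_; _+_; _-_; _*_)
open import Data.Rational.Properties
  using (normalize-coprime; /-cong; +-0-monoid)
open import Data.Rational.Solver using (module +-*-Solver)
open import Algebra.Properties.Monoid.Sum +-0-monoid using (sum-init-last; sum-cong-≗)
open import Function.Base using (_∘_)
open import Relation.Binary.PropositionalEquality.Core
  using (_≡_; refl; sym; trans; cong; cong₂)
open import Relation.Binary.PropositionalEquality.Properties using (module ≡-Reasoning)
open ≡-Reasoning
open +-*-Solver using (solve; con; _:=_; _:+_; _:-_; _:*_)

-- For a variable `k`, `ι k` is stuck on the gcd in its normalisation, so the sum does not compute.
-- Once both terms are in `mkℚ` form with denominator 1, rational addition unfolds.
ι-homo-+ : ∀ m n → ι (m ℕ.+ n) ≡ ι m + ι n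
ι-homo-+ m n = begin
  ι (m ℕ.+ n)                              ≡⟨ /-cong (cong₂ ℤ._+_ (*1 m) (*1 n)) refl ⟩
  ((+ m ℤ.* + 1) ℤ.+ (+ n ℤ.* + 1)) ℚ./ 1  ≡⟨ cong₂ _+_ (ι-mkℚ m) (ι-mkℚ n) ⟨
  ι m + ι n                                ∎
  where
  *1 : ∀ k → + k ≡ + k ℤ.* + 1
  *1 k = sym (ℤ.*-identityʳ (+ k))

  ι-mkℚ : ∀ k → ι k ≡ ℚ.mkℚ (+ k) 0 _
  ι-mkℚ k = normalize-coprime (Coprimality.sym (Coprimality.1-coprimeTo k))

-- The case split lets the integer negation reduce. Positive powers need no such lemma, since
-- `ι 4 ^ (+ suc n)` unfolds by itself.
4^-suc : ∀ n → ι 4 ^ (- (+ suc n)) ≡ 1/ ι 4 * ι 4 ^ (- (+ n))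
4^-suc zero    = refl
4^-suc (suc n) = refl

sumFromTo-last : ∀ m (f : ℕ → ℚ) →
  ∑[ k from 1 to suc m ] f k ≡ ∑[ k from 1 to m ] f k + f (suc m)
sumFromTo-last m f = trans (sum-init-last {m} (λ i → f (suc (toℕ i))))
  (cong₂ _+_
    (sum-cong-≗ {m} (λ i → cong (f ∘ suc) (toℕ-inject₁ i)))
    (cong (f ∘ suc) (toℕ-fromℕ m)))

d : ℕ → ℚ
d k = ι 4 ^ (+ k) - ι 4 ^ (- (+ k))

-- g k ≡ a (m ∸ k) for k ≤ m, in a form that avoids truncated subtraction.
convolution : ∀ p (a : ℕ → ℚ) → (∀ j → a (2 ℕ.+ j) + a j ≡ p * a (1 ℕ.+ j)) →
  ∀ m (g : ℕ → ℚ) → (∀ k j → k ℕ.+ j ≡ m → g k ≡ a j) →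
  ι 15 * g 0
    ≡ (ι 4 * a 0 + (a 1 - p * a 0)) * ι 4 ^ (+ suc m)
      - (ι 4 * a 0 + ι 16 * (a 1 - p * a 0)) * ι 4 ^ (- (+ suc m))
      + (ι 4 * p - ι 17) * ∑[ k from 1 to m ] (d k * g k)
-- Write e for `a 1 - p * a 0`, the negative of the term that the recurrence would put before `a 0`.
-- The factor 15 is 4 · 4 - 4 / 4, and the weight 16 makes e cancel: 4e - 16e / 4 = 0.
convolution p a rec zero g g≡a rewrite g≡a 0 0 refl =
  solve 3 (λ a₀ a₁ p →
      con (ι 15) :* a₀
        := (con (ι 4) :* a₀ :+ (a₁ :- p :* a₀)) :* con (ι 4)
           :- (con (ι 4) :* a₀ :+ con (ι 16) :* (a₁ :- p :* a₀)) :* con (1/ ι 4)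
           :+ (con (ι 4) :* p :- con (ι 17)) :* con (ι 0))
    refl (a 0) (a 1) p
convolution p a rec (suc m) g g≡a = begin
  ι 15 * g 0
    ≡⟨ convolution p (a ∘ suc) (rec ∘ suc) m g
         (λ k j k+j≡m → g≡a k (suc j) (trans (ℕ.+-suc k j) (cong suc k+j≡m))) ⟩
  (ι 4 * a 1 + (a 2 - p * a 1)) * X - (ι 4 * a 1 + ι 16 * (a 2 - p * a 1)) * Y + q * S
    -- Trading `p * a 1` for `a 2 + a 0` turns the e of the shortened sequence into `- a 0`.
    ≡⟨ cong (λ z → (ι 4 * a 1 + (a 2 - z)) * X - (ι 4 * a 1 + ι 16 * (a 2 - z)) * Y + q * S)
         (rec 0) ⟨
  (ι 4 * a 1 + (a 2 - (a 2 + a 0))) * X - (ι 4 * a 1 + ι 16 * (a 2 - (a 2 + a 0))) * Y + q * S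
    -- The terms in `p * a 0` cancel. What remains is 16 - 17 = -1 at `X * a 0` and 1 - 17 = -16
    -- inside the coefficient subtracted at `Y`.
    ≡⟨ solve 7 (λ a₀ a₁ a₂ p X Y S →
           (con (ι 4) :* a₁ :+ (a₂ :- (a₂ :+ a₀))) :* X
             :- (con (ι 4) :* a₁ :+ con (ι 16) :* (a₂ :- (a₂ :+ a₀))) :* Y
             :+ (con (ι 4) :* p :- con (ι 17)) :* S
           := (con (ι 4) :* a₀ :+ (a₁ :- p :* a₀)) :* (con (ι 4) :* X)
              :- (con (ι 4) :* a₀ :+ con (ι 16) :* (a₁ :- p :* a₀)) :* (con (1/ ι 4) :* Y)
              :+ (con (ι 4) :* p :- con (ι 17)) :* (S :+ (X :- Y) :* a₀))
         refl (a 0) (a 1) (a 2) p X Y S ⟩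
  A * (ι 4 * X) - B * (1/ ι 4 * Y) + q * (S + (X - Y) * a 0)
    ≡⟨ cong₂ (λ y z → A * (ι 4 * X) - B * y + q * (S + (X - Y) * z))
         (4^-suc (suc m)) (g≡a (suc m) 0 (ℕ.+-identityʳ (suc m))) ⟨
  A * (ι 4 * X) - B * ι 4 ^ (- (+ suc (suc m))) + q * (S + d (suc m) * g (suc m))
    ≡⟨ cong (λ s → A * (ι 4 * X) - B * ι 4 ^ (- (+ suc (suc m))) + q * s)
         (sumFromTo-last m (λ k → d k * g k)) ⟨
  A * (ι 4 * X) - B * ι 4 ^ (- (+ suc (suc m))) + q * ∑[ k from 1 to suc m ] (d k * g k)
    ∎
  where
  X = ι 4 ^ (+ suc m)
  Y = ι 4 ^ (- (+ suc m))
  S = ∑[ k from 1 to m ] (d k * g k)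
  q = ι 4 * p - ι 17
  A = ι 4 * a 0 + (a 1 - p * a 0)
  B = ι 4 * a 0 + ι 16 * (a 1 - p * a 0)

module _ (w : ℕ → ℚ) (step : ∀ n → w (2 ℕ.+ n) ≡ w (1 ℕ.+ n) + w n) where

  -- The factors 3 and 7 here and in `stride-4` are `L 2` and `L 4`.
  stride-2 : ∀ n → w (4 ℕ.+ n) + w n ≡ ι 3 * w (2 ℕ.+ n)
  stride-2 n rewrite step (2 ℕ.+ n) | step (1 ℕ.+ n) | step n =
    solve 2 (λ v u → (v :+ u :+ v) :+ (v :+ u) :+ u := con (ι 3) :* (v :+ u))
      refl (w (1 ℕ.+ n)) (w n)

  stride-4 : ∀ n → w (8 ℕ.+ n) + w n ≡ ι 7 * w (4 ℕ.+ n)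
  stride-4 n = begin
    w (8 ℕ.+ n) + w n
      -- Inserting the middle term twice allows three uses of `stride-2`, whence 7 = 3 · 3 - 2.
      ≡⟨ solve 3 (λ w₈ w₄ w₀ → w₈ :+ w₀
             := (w₈ :+ w₄) :+ (w₄ :+ w₀) :- con (ι 2) :* w₄)
           refl (w (8 ℕ.+ n)) (w (4 ℕ.+ n)) (w n) ⟩
    (w (8 ℕ.+ n) + w (4 ℕ.+ n)) + (w (4 ℕ.+ n) + w n) - ι 2 * w (4 ℕ.+ n)
      ≡⟨ cong₂ (λ x y → x + y - ι 2 * w (4 ℕ.+ n)) (stride-2 (4 ℕ.+ n)) (stride-2 n) ⟩
    ι 3 * w (6 ℕ.+ n) + ι 3 * w (2 ℕ.+ n) - ι 2 * w (4 ℕ.+ n)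
      ≡⟨ solve 3 (λ w₆ w₄ w₂ → con (ι 3) :* w₆ :+ con (ι 3) :* w₂ :- con (ι 2) :* w₄
             := con (ι 3) :* (w₆ :+ w₂) :- con (ι 2) :* w₄)
           refl (w (6 ℕ.+ n)) (w (4 ℕ.+ n)) (w (2 ℕ.+ n)) ⟩
    ι 3 * (w (6 ℕ.+ n) + w (2 ℕ.+ n)) - ι 2 * w (4 ℕ.+ n)
      ≡⟨ cong (λ x → ι 3 * x - ι 2 * w (4 ℕ.+ n)) (stride-2 (2 ℕ.+ n)) ⟩
    ι 3 * (ι 3 * w (4 ℕ.+ n)) - ι 2 * w (4 ℕ.+ n)
      ≡⟨ solve 1 (λ w₄ → con (ι 3) :* (con (ι 3) :* w₄) :- con (ι 2) :* w₄ := con (ι 7) :* w₄)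
           refl (w (4 ℕ.+ n)) ⟩
    ι 7 * w (4 ℕ.+ n)
      ∎

F-step : ∀ n → ι (F (2 ℕ.+ n)) ≡ ι (F (1 ℕ.+ n)) + ι (F n)
F-step n = ι-homo-+ (F (1 ℕ.+ n)) (F n)

L-step : ∀ n → ι (L (2 ℕ.+ n)) ≡ ι (L (1 ℕ.+ n)) + ι (L n)
L-step n = ι-homo-+ (L (1 ℕ.+ n)) (L n)

1+[k+j]∸k≡1+j : ∀ k j → suc (k ℕ.+ j) ∸ k ≡ suc j
1+[k+j]∸k≡1+j k j = trans (cong (_∸ k) (sym (ℕ.+-suc k j))) (ℕ.m+n∸m≡n k (suc j))

-- The factor `c` ends up on the right because `suc j ℕ.* c` unfolds to `c ℕ.+ j ℕ.* c` for a
-- numeral `c`, the form in which the stride lemmas apply.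
c*[1+[k+j]∸k]≡[1+j]*c : ∀ c k j → c ℕ.* (suc (k ℕ.+ j) ∸ k) ≡ suc j ℕ.* c
c*[1+[k+j]∸k]≡[1+j]*c c k j =
  trans (cong (c ℕ.*_) (1+[k+j]∸k≡1+j k j)) (ℕ.*-comm c (suc j))

c*[1+[k+j]∸k∸1]≡j*c : ∀ c k j → c ℕ.* (suc (k ℕ.+ j) ∸ k ∸ 1) ≡ j ℕ.* c
c*[1+[k+j]∸k∸1]≡j*c c k j =
  trans (cong (λ i → c ℕ.* (i ∸ 1)) (1+[k+j]∸k≡1+j k j)) (ℕ.*-comm c j)

2*[2*[1+[k+j]]∸2*k∸1]≡2+j*4 : ∀ k j →
  2 ℕ.* (2 ℕ.* suc (k ℕ.+ j) ∸ 2 ℕ.* k ∸ 1) ≡ 2 ℕ.+ j ℕ.* 4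
2*[2*[1+[k+j]]∸2*k∸1]≡2+j*4 k j = begin
  2 ℕ.* (2 ℕ.* suc (k ℕ.+ j) ∸ 2 ℕ.* k ∸ 1)
    ≡⟨ cong (λ i → 2 ℕ.* (i ∸ 1)) (ℕ.*-distribˡ-∸ 2 (suc (k ℕ.+ j)) k) ⟨
  2 ℕ.* (2 ℕ.* (suc (k ℕ.+ j) ∸ k) ∸ 1)
    ≡⟨ cong (λ i → 2 ℕ.* (2 ℕ.* i ∸ 1)) (1+[k+j]∸k≡1+j k j) ⟩
  2 ℕ.* (j ℕ.+ (suc j ℕ.+ 0))
    -- `2 ℕ.* suc j ∸ 1` has already computed to `j ℕ.+ (suc j ℕ.+ 0)`, so no subtraction is left
    -- for the solver.
    ≡⟨ ℕ-solve 1 (λ j → ℕ-con 2 ⊛ (j ⊕ (ℕ-con 1 ⊕ j ⊕ ℕ-con 0)) ⊜ ℕ-con 2 ⊕ j ⊛ ℕ-con 4)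
         refl j ⟩
  2 ℕ.+ j ℕ.* 4
    ∎
  where
  open ℕ.+-*-Solver renaming
    (solve to ℕ-solve; con to ℕ-con; _:*_ to _⊛_; _:+_ to _⊕_; _:=_ to _⊜_)

corollary9 : (n : ℕ) → n ≥ 1 →
    (ι 15 * ι (F (2 ℕ.* (2 ℕ.* n ∸ 1)))
    ≡ ι 5 * ι 4 ^ (+ n) - ι 20 * ι 4 ^ (- (+ n))
    + ι 11 * ∑[ k from 1 to n ∸ 1 ] ((ι 4 ^ (+ k) - ι 4 ^ (- (+ k))) * ι (F (2 ℕ.* (2 ℕ.* n ∸ 2 ℕ.* k ∸ 1)))))
    × (ι 15 * ι (F (4 ℕ.* n))
    ≡ ι 12 * (ι 4 ^ (+ n) - ι 4 ^ (- (+ n)))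
    + ι 11 * ∑[ k from 1 to n ∸ 1 ] ((ι 4 ^ (+ k) - ι 4 ^ (- (+ k))) * ι (F (4 ℕ.* (n ∸ k)))))
    × (ι 15 * ι (F (2 ℕ.* n))
    ≡ ι 4 * (ι 4 ^ (+ n) - ι 4 ^ (- (+ n)))
    - ι 5 * ∑[ k from 1 to n ∸ 1 ] ((ι 4 ^ (+ k) - ι 4 ^ (- (+ k))) * ι (F (2 ℕ.* (n ∸ k)))))
    × (ι 15 * ι (L (4 ℕ.* (n ∸ 1)))
    ≡ ι 4 ^ (+ n) + ι 104 * ι 4 ^ (- (+ n))
    + ι 11 * ∑[ k from 1 to n ∸ 1 ] ((ι 4 ^ (+ k) - ι 4 ^ (- (+ k))) * ι (L (4 ℕ.* (n ∸ k ∸ 1)))))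
    × (ι 15 * ι (L (2 ℕ.* (2 ℕ.* n ∸ 1)))
    ≡ ι 9 * ι 4 ^ (+ n) + ι 36 * ι 4 ^ (- (+ n))
    + ι 11 * ∑[ k from 1 to n ∸ 1 ] ((ι 4 ^ (+ k) - ι 4 ^ (- (+ k))) * ι (L (2 ℕ.* (2 ℕ.* n ∸ 2 ℕ.* k ∸ 1)))))
    × (ι 3 * ι (L (2 ℕ.* n ∸ 2))
    ≡ ι 4 ^ (+ n) + ι 8 * ι 4 ^ (- (+ n))
    - ∑[ k from 0 to n ∸ 1 ] ((ι 4 ^ (+ k) - ι 4 ^ (- (+ k))) * ι (L (2 ℕ.* (n ∸ k ∸ 1)))))
corollary9 n@(suc m) _ =
    -- The numerical coefficients are 4 a₀ + e and 4 a₀ + 16 e with e = a₁ - p a₀. For the six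
    -- identities in order, (a₀, e) is (1, 1), (3, 0), (1, 0), (2, -7), (3, -3), (2, -3).
    convolution (ι 7) (λ j → ι (F (2 ℕ.+ j ℕ.* 4)))
      (λ j → stride-4 (ι ∘ F) F-step (2 ℕ.+ j ℕ.* 4)) m
      (λ k → ι (F (2 ℕ.* (2 ℕ.* n ∸ 2 ℕ.* k ∸ 1))))
      (λ { k j refl → cong (ι ∘ F) (2*[2*[1+[k+j]]∸2*k∸1]≡2+j*4 k j) })
  , trans
      (convolution (ι 7) (λ j → ι (F (suc j ℕ.* 4)))
        (λ j → stride-4 (ι ∘ F) F-step (suc j ℕ.* 4)) m
        (λ k → ι (F (4 ℕ.* (n ∸ k))))
        (λ { k j refl → cong (ι ∘ F) (c*[1+[k+j]∸k]≡[1+j]*c 4 k j) }))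
      (solve 3 (λ X Y S → con (ι 12) :* X :- con (ι 12) :* Y :+ con (ι 11) :* S
          := con (ι 12) :* (X :- Y) :+ con (ι 11) :* S)
        refl X Y (S (λ k → ι (F (4 ℕ.* (n ∸ k))))))
  , trans
      (convolution (ι 3) (λ j → ι (F (suc j ℕ.* 2)))
        (λ j → stride-2 (ι ∘ F) F-step (suc j ℕ.* 2)) m
        (λ k → ι (F (2 ℕ.* (n ∸ k))))
        (λ { k j refl → cong (ι ∘ F) (c*[1+[k+j]∸k]≡[1+j]*c 2 k j) }))
      (solve 3 (λ X Y S → con (ι 4) :* X :- con (ι 4) :* Y :+ con (ℚ.- ι 5) :* S
          := con (ι 4) :* (X :- Y) :- con (ι 5) :* S)
        refl X Y (S (λ k → ι (F (2 ℕ.* (n ∸ k))))))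
  , trans
      (convolution (ι 7) (λ j → ι (L (j ℕ.* 4)))
        (λ j → stride-4 (ι ∘ L) L-step (j ℕ.* 4)) m
        (λ k → ι (L (4 ℕ.* (n ∸ k ∸ 1))))
        (λ { k j refl → cong (ι ∘ L) (c*[1+[k+j]∸k∸1]≡j*c 4 k j) }))
      (solve 3 (λ X Y S → con (ι 1) :* X :- con (ℚ.- ι 104) :* Y :+ con (ι 11) :* S
          := X :+ con (ι 104) :* Y :+ con (ι 11) :* S)
        refl X Y (S (λ k → ι (L (4 ℕ.* (n ∸ k ∸ 1))))))
  , trans
      (convolution (ι 7) (λ j → ι (L (2 ℕ.+ j ℕ.* 4)))
        (λ j → stride-4 (ι ∘ L) L-step (2 ℕ.+ j ℕ.* 4)) m
        (λ k → ι (L (2 ℕ.* (2 ℕ.* n ∸ 2 ℕ.* k ∸ 1))))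
        (λ { k j refl → cong (ι ∘ L) (2*[2*[1+[k+j]]∸2*k∸1]≡2+j*4 k j) }))
      (solve 3 (λ X Y S → con (ι 9) :* X :- con (ℚ.- ι 36) :* Y :+ con (ι 11) :* S
          := con (ι 9) :* X :+ con (ι 36) :* Y :+ con (ι 11) :* S)
        refl X Y (S (λ k → ι (L (2 ℕ.* (2 ℕ.* n ∸ 2 ℕ.* k ∸ 1))))))
  , (begin
      ι 3 * ι (L (2 ℕ.* n ∸ 2))
        ≡⟨ cong (λ i → ι 3 * ι (L i)) (ℕ.*-distribˡ-∸ 2 n 1) ⟨
      ι 3 * ι (L (2 ℕ.* m))
        -- Here the coefficients 5, -40 and -5 share the factor 5, which is divided out.
        ≡⟨ solve 1 (λ l → con (ι 3) :* l := con (1/ ι 5) :* (con (ι 15) :* l)) refl (ι (L (2 ℕ.* m))) ⟩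
      1/ ι 5 * (ι 15 * ι (L (2 ℕ.* m)))
        ≡⟨ cong (1/ ι 5 *_)
             (convolution (ι 3) (λ j → ι (L (j ℕ.* 2)))
               (λ j → stride-2 (ι ∘ L) L-step (j ℕ.* 2)) m
               (λ k → ι (L (2 ℕ.* (n ∸ k ∸ 1))))
               (λ { k j refl → cong (ι ∘ L) (c*[1+[k+j]∸k∸1]≡j*c 2 k j) })) ⟩
      1/ ι 5 * (ι 5 * X - ℚ.- ι 40 * Y + ℚ.- ι 5 * S (λ k → ι (L (2 ℕ.* (n ∸ k ∸ 1)))))
        -- The sum now starts at `k = 0`, where the extra summand vanishes because `d 0` evaluates
        -- to 0.
        ≡⟨ solve 4 (λ X Y S l →
               con (1/ ι 5) :* (con (ι 5) :* X :- con (ℚ.- ι 40) :* Y :+ con (ℚ.- ι 5) :* S)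
               := X :+ con (ι 8) :* Y :- (con (d 0) :* l :+ S))
             refl X Y (S (λ k → ι (L (2 ℕ.* (n ∸ k ∸ 1))))) (ι (L (2 ℕ.* m))) ⟩
      X + ι 8 * Y - ∑[ k from 0 to m ] (d k * ι (L (2 ℕ.* (n ∸ k ∸ 1))))
        ∎)
  where
  X = ι 4 ^ (+ n)
  Y = ι 4 ^ (- (+ n))
  S : (ℕ → ℚ) → ℚ
  S g = ∑[ k from 1 to m ] (d k * g k)
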